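{- Let $a,b$ and $M$ be integers satisfying $1\le a<b<\frac{M}{2}$ and $\gcd(b,M)=1$. For an integer $L\geq 0$, define $d(m,n)$ (depending on $L$) by $$(-zq^a,-zq^{M-a};q^M)_{L}\left(1+zq^{LM+a}\right) - (-zq^b,-zq^{M-b};q^M)_{L} =: \sum_{m,n\geq 0} d(m,n)z^mq^n.$$ Then for all integers $L,m,n\geq 0$ we have $d(m,nM)\geq 0$. If in addition $M$ is even and $a$ is odd, then also $d\left(m,nM+\frac{M}{2}\right)\geq 0$ for all integers $L,m,n\geq 0$.
   Context: Notation: $(x;q)_n := \prod_{j=0}^{n-1}(1-xq^j)$ and $(x_1,\dots,x_r;q)_n := (x_1;q)_n\cdots(x_r;q)_n$, with empty products equal to $1$; thus $(-zq^s,-zq^t;q^M)_L=\prod_{j=0}^{L-1}(1+zq^{Mj+s})(1+zq^{Mj+t})$. -}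

module Defs where

open import Algebra.Bundles.Raw using (RawRing)
open import Data.Fin.Base using (toℕ)
open import Data.Integer.Base as ℤ using (ℤ)
open import Data.Nat.Base as ℕ using (ℕ; zero; suc; _∸_)
import Algebra.Definitions.RawSemiring as RawSemiringDefs

-- Formal power series R[[X]], as coefficient sequences under the Cauchy
-- product.
module PowerSeries {c ℓ} (R : RawRing c ℓ) where
  open RawRing R
  open RawSemiringDefs rawSemiring using (sum)

  Series : Set c
  Series = ℕ → Carrier

  const : Carrier → Series
  const x zero    = x
  const x (suc _) = 0#

  X : Series
  X 1 = 1#
  X _ = 0#

  rawRing : RawRing c ℓ
  rawRing = record
    { Carrier = Series
    ; _≈_     = λ f g → ∀ n → f n ≈ g n
    ; _+_     = λ f g n → f n + g n
    ; _*_     = λ f g n → sum {suc n} (λ i → f (toℕ i) * g (n ∸ toℕ i))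
    ; -_      = λ f n → - f n
    ; 0#      = const 0#
    ; 1#      = const 1#
    }

module QPochhammer {c ℓ} (R : RawRing c ℓ) where
  open RawRing R
  open RawSemiringDefs rawSemiring using (product; _^_)

  -- ⟨ x ⨾ q ⟩ n is (x;q)ₙ.
  ⟨_⨾_⟩_ : Carrier → Carrier → ℕ → Carrier
  ⟨ x ⨾ q ⟩ n = product {n} (λ j → 1# + - (x * q ^ toℕ j))

  -- ⟨ x , y ⨾ q ⟩ n is (x,y;q)ₙ.
  ⟨_,_⨾_⟩_ : Carrier → Carrier → Carrier → ℕ → Carrier
  ⟨ x , y ⨾ q ⟩ n = (⟨ x ⨾ q ⟩ n) * (⟨ y ⨾ q ⟩ n)

module ℤ⟦q⟧   = PowerSeries ℤ.+-*-rawRing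
module ℤ⟦q,z⟧ = PowerSeries ℤ⟦q⟧.rawRing

open RawRing ℤ⟦q,z⟧.rawRing
open RawSemiringDefs rawSemiring using (_^_)
open QPochhammer ℤ⟦q,z⟧.rawRing

-- The ring is ℤ[[q]][[z]], so F m n is the coefficient of zᵐqⁿ in F.
z q : Carrier
z = ℤ⟦q,z⟧.X
q = ℤ⟦q,z⟧.const ℤ⟦q⟧.X

-- The exponent M ∸ b (and likewise M ∸ a) is M − b whenever b ≤ M; the
-- truncation is harmless for a < b < M / 2.
difference : (a b M L : ℕ) → Carrier
difference a b M L =
  (⟨ - (z * q ^ a) , - (z * q ^ (M ∸ a)) ⨾ q ^ M ⟩ L)
    * (1# + z * q ^ (L ℕ.* M ℕ.+ a))
  + - (⟨ - (z * q ^ b) , - (z * q ^ (M ∸ b)) ⨾ q ^ M ⟩ L)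

d : (a b M L m n : ℕ) → ℤ
d a b M L m n = difference a b M L m n

{-# OPTIONS --safe #-}
module Submission where

-- Expand both products by the q-binomial theorem in base Q = q^M. The terms
-- with i parts in the class of a (or b) and j = i - l parts in the opposite
-- class, taken together with those with i and j exchanged, differ by
--   c q^(la) ( [L+1,i][L,j] + Q^(r+s) [L,i][L+1,j] - (Q^r + Q^s) [L,i][L,j] ),
-- where c is a monomial, r = l (b - a) / M and s = l (M - a - b) / M. At the
-- exponents in question either r and s are integers or the b-terms do not
-- contribute at all. For integral r ≠ s in [0, i],
--   [L+1,i] - (Q^r + Q^s) [L,i] + Q^(r+s) [L-1,i]
-- has nonnegative coefficients: [n,i] is the complete homogeneous symmetric
-- polynomial of degree n - i in 1, Q, …, Qⁱ, and the alternating sum deletes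
-- the variables Q^r and Q^s from it. What remains is
-- Q^(r+s) ([L,i][L+1,j] - [L-1,i][L,j]), which is nonnegative because Gaussian
-- binomials increase with their upper index.

open import Defs
open import Algebra.Bundles using (CommutativeRing; CommutativeSemiring; RawRing)
open import Data.Fin.Base using (Fin; toℕ; fromℕ; inject₁) renaming (zero to fzero; suc to fsuc)
open import Data.Fin.Properties using (toℕ-fromℕ; toℕ-inject₁; toℕ≤pred[n])
open import Data.Integer.Base as ℤ using (ℤ; 0ℤ) renaming (_≤_ to _≤ℤ_)
import Data.Integer.Properties as ℤ
open import Data.List.Base using (List; []; _∷_; downFrom)
open import Data.List.Membership.Propositional using (_∈_)
open import Data.List.Membership.Propositional.Properties using (∈-∃++; ∈-downFrom⁺)
open import Data.List.Relation.Binary.Permutation.Propositional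
  using (_↭_; prep; swap; ↭-trans)
open import Data.List.Relation.Binary.Permutation.Propositional.Properties
  using (shift; ∈-resp-↭)
open import Data.List.Relation.Unary.Any using (here; there)
open import Data.Nat.Base as ℕ using (ℕ; zero; suc; _∸_; _≤_; _<_; s≤s; z≤n; NonZero)
open import Data.Nat.Coprimality using (Coprime; gcd≡1⇒coprime; coprime-divisor)
import Data.Nat.Coprimality as Coprimality
open import Data.Nat.DivMod using (_/_; m/n*n≡m)
open import Data.Nat.Divisibility
  using (_∣_; _∤_; _∣?_; divides; divides-refl; ∣1⇒≡1; ∣-refl;
    ∣m⇒∣m*n; ∣n⇒∣m*n; ∣m+n∣m⇒∣n; ∣m∣n⇒∣m+n; m∣m*n)
open import Data.Nat.GCD using (gcd; gcd-greatest)
import Data.Nat.Properties as ℕ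
open import Data.Nat.Tactic.RingSolver using (solve-∀)
open import Data.Product.Base using (_,_; _×_; proj₁; proj₂; ∃-syntax)
open import Data.Sum.Base using (_⊎_; inj₁; inj₂)
open import Level using (_⊔_)
open import Relation.Binary.PropositionalEquality as ≡ using (_≡_; _≢_)
open import Relation.Nullary.Decidable.Core using (Dec; yes; no; _×-dec_)
open import Relation.Nullary.Negation using (¬_; contradiction)

-- Formal power series over a commutative ring form a commutative ring.

module PowerSeriesProperties {c ℓ} (R : CommutativeRing c ℓ) where
  open CommutativeRing R
  open PowerSeries rawRing
    using (Series; const; X) renaming (rawRing to seriesRawRing)
  open RawRing seriesRawRing using ()
    renaming (_≈_ to _≈ₛ_; _+_ to _+ₛ_; _*_ to _*ₛ_; 0# to 0ₛ; 1# to 1ₛ)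
  open import Algebra.Properties.CommutativeMonoid.Sum +-commutativeMonoid
    using (sum-cong-≋)
  open import Algebra.Properties.CommutativeSemigroup +-commutativeSemigroup
    using (interchange; x∙yz≈y∙xz)
  open import Relation.Binary.Reasoning.Setoid setoid

  tail : Series → Series
  tail f n = f (suc n)

  -- The inductions below rest on the definitional unfolding
  -- (f *ₛ g) (suc n) = f 0 * g (suc n) + (tail f *ₛ g) n.
  *ₛ-cong : ∀ {f f′ g g′} → f ≈ₛ f′ → g ≈ₛ g′ → f *ₛ g ≈ₛ f′ *ₛ g′
  *ₛ-cong f≈f′ g≈g′ n = sum-cong-≋ {suc n} λ i → *-cong (f≈f′ (toℕ i)) (g≈g′ (n ∸ toℕ i))

  -- Stated for pointwise scaling because `tail (f *ₛ g)` unfolds to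
  -- `(λ k → f 0 * tail g k) +ₛ (tail f *ₛ g)`, the form met in `*ₛ-assoc`.
  scale-*ₛ : ∀ x f g → (λ n → x * f n) *ₛ g ≈ₛ λ n → x * (f *ₛ g) n
  scale-*ₛ x f g zero = begin
    x * f 0 * g 0 + 0#        ≈⟨ +-cong (*-assoc x _ _) (sym (zeroʳ x)) ⟩
    x * (f 0 * g 0) + x * 0#  ≈⟨ distribˡ x _ _ ⟨
    x * (f 0 * g 0 + 0#)      ∎
  scale-*ₛ x f g (suc n) = begin
    x * f 0 * g (suc n) + ((λ k → x * tail f k) *ₛ g) n
      ≈⟨ +-cong (*-assoc x _ _) (scale-*ₛ x (tail f) g n) ⟩
    x * (f 0 * g (suc n)) + x * (tail f *ₛ g) n
      ≈⟨ distribˡ x _ _ ⟨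
    x * (f *ₛ g) (suc n) ∎

  *ₛ-distribʳ : ∀ h f g → (f +ₛ g) *ₛ h ≈ₛ (f *ₛ h) +ₛ (g *ₛ h)
  *ₛ-distribʳ h f g zero = begin
    (f 0 + g 0) * h 0 + 0#
      ≈⟨ +-cong (distribʳ (h 0) _ _) (sym (+-identityʳ 0#)) ⟩
    f 0 * h 0 + g 0 * h 0 + (0# + 0#)
      ≈⟨ interchange _ _ _ _ ⟩
    f 0 * h 0 + 0# + (g 0 * h 0 + 0#) ∎
  *ₛ-distribʳ h f g (suc n) = begin
    (f 0 + g 0) * h (suc n) + ((tail f +ₛ tail g) *ₛ h) n
      ≈⟨ +-cong (distribʳ (h (suc n)) _ _) (*ₛ-distribʳ h (tail f) (tail g) n) ⟩
    f 0 * h (suc n) + g 0 * h (suc n) + ((tail f *ₛ h) n + (tail g *ₛ h) n)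
      ≈⟨ interchange _ _ _ _ ⟩
    (f *ₛ h) (suc n) + (g *ₛ h) (suc n) ∎

  -- The definition splits off the first summand; commutativity reverses the sum and so needs the
  -- last one split off as well.
  *ₛ-suc-last : ∀ f g n → (f *ₛ g) (suc n) ≈ f (suc n) * g 0 + (f *ₛ tail g) n
  *ₛ-suc-last f g zero = begin
    f 0 * g 1 + (f 1 * g 0 + 0#)  ≈⟨ x∙yz≈y∙xz _ _ _ ⟩
    f 1 * g 0 + (f 0 * g 1 + 0#)  ∎
  *ₛ-suc-last f g (suc n) = begin
    f 0 * g (2 ℕ.+ n) + (tail f *ₛ g) (suc n)
      ≈⟨ +-congˡ (*ₛ-suc-last (tail f) g n) ⟩
    f 0 * g (2 ℕ.+ n) + (f (2 ℕ.+ n) * g 0 + (tail f *ₛ tail g) n)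
      ≈⟨ x∙yz≈y∙xz _ _ _ ⟩
    f (2 ℕ.+ n) * g 0 + (f *ₛ tail g) (suc n) ∎

  *ₛ-comm : ∀ f g → f *ₛ g ≈ₛ g *ₛ f
  *ₛ-comm f g zero    = +-congʳ (*-comm (f 0) (g 0))
  *ₛ-comm f g (suc n) = begin
    f 0 * g (suc n) + (tail f *ₛ g) n  ≈⟨ +-cong (*-comm _ _) (*ₛ-comm (tail f) g n) ⟩
    g (suc n) * f 0 + (g *ₛ tail f) n  ≈⟨ *ₛ-suc-last g f n ⟨
    (g *ₛ f) (suc n)                   ∎

  *ₛ-assoc : ∀ f g h → (f *ₛ g) *ₛ h ≈ₛ f *ₛ (g *ₛ h)
  *ₛ-assoc f g h zero = +-congʳ (begin
    (f 0 * g 0 + 0#) * h 0  ≈⟨ *-congʳ (+-identityʳ _) ⟩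
    f 0 * g 0 * h 0         ≈⟨ *-assoc _ _ _ ⟩
    f 0 * (g 0 * h 0)       ≈⟨ *-congˡ (+-identityʳ _) ⟨
    f 0 * (g 0 * h 0 + 0#)  ∎)
  *ₛ-assoc f g h (suc n) = begin
    (f 0 * g 0 + 0#) * h (suc n) + (tail (f *ₛ g) *ₛ h) n
      ≈⟨ +-cong (trans (*-congʳ (+-identityʳ _)) (*-assoc _ _ _))
                (*ₛ-distribʳ h (λ k → f 0 * tail g k) (tail f *ₛ g) n) ⟩
    f 0 * (g 0 * h (suc n)) + (((λ k → f 0 * tail g k) *ₛ h) n + ((tail f *ₛ g) *ₛ h) n)
      ≈⟨ +-congˡ (+-cong (scale-*ₛ (f 0) (tail g) h n) (*ₛ-assoc (tail f) g h n)) ⟩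
    f 0 * (g 0 * h (suc n)) + (f 0 * (tail g *ₛ h) n + (tail f *ₛ (g *ₛ h)) n)
      ≈⟨ +-assoc _ _ _ ⟨
    f 0 * (g 0 * h (suc n)) + f 0 * (tail g *ₛ h) n + (tail f *ₛ (g *ₛ h)) n
      ≈⟨ +-congʳ (distribˡ (f 0) _ _) ⟨
    (f *ₛ (g *ₛ h)) (suc n) ∎

  -- `0ₛ` is `const 0#`, which reduces only once its argument is a constructor.
  0ₛ-zero : ∀ n → 0ₛ n ≈ 0#
  0ₛ-zero zero    = refl
  0ₛ-zero (suc n) = refl

  *ₛ-zeroˡ : ∀ {f} g → (∀ n → f n ≈ 0#) → ∀ n → (f *ₛ g) n ≈ 0#
  *ₛ-zeroˡ g f≈0 zero    = trans (+-identityʳ _) (trans (*-congʳ (f≈0 0)) (zeroˡ (g 0)))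
  *ₛ-zeroˡ g f≈0 (suc n) = trans
    (+-cong (trans (*-congʳ (f≈0 0)) (zeroˡ _)) (*ₛ-zeroˡ g (λ k → f≈0 (suc k)) n))
    (+-identityʳ 0#)

  const-*ₛ : ∀ x g n → (const x *ₛ g) n ≈ x * g n
  const-*ₛ x g zero    = +-identityʳ _
  const-*ₛ x g (suc n) = trans (+-congˡ (*ₛ-zeroˡ g (λ _ → refl) n)) (+-identityʳ _)

  *ₛ-identityˡ : ∀ f → 1ₛ *ₛ f ≈ₛ f
  *ₛ-identityˡ f n = trans (const-*ₛ 1# f n) (*-identityˡ (f n))

  X-*ₛ-zero : ∀ f → (X *ₛ f) 0 ≈ 0#
  X-*ₛ-zero f = trans (+-identityʳ _) (zeroˡ (f 0))

  X-*ₛ-suc : ∀ f n → (X *ₛ f) (suc n) ≈ f n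
  X-*ₛ-suc f n = begin
    0# * f (suc n) + (tail X *ₛ f) n
      ≈⟨ +-cong (zeroˡ _) (*ₛ-cong {g = f} tailX≈1 (λ _ → refl) n) ⟩
    0# + (1ₛ *ₛ f) n  ≈⟨ +-identityˡ _ ⟩
    (1ₛ *ₛ f) n       ≈⟨ *ₛ-identityˡ f n ⟩
    f n               ∎
    where
    tailX≈1 : tail X ≈ₛ 1ₛ
    tailX≈1 zero    = refl
    tailX≈1 (suc _) = refl

  commutativeRing : CommutativeRing c ℓ
  commutativeRing = record
    { RawRing seriesRawRing
    ; isCommutativeRing = record
      { isRing = record
        { +-isAbelianGroup = record
          { isGroup = record
            { isMonoid = record
              { isSemigroup = record
                { isMagma = record
                  { isEquivalence = record
                    { refl  = λ n → refl
                    ; sym   = λ f≈g n → sym (f≈g n)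
                    ; trans = λ f≈g g≈h n → trans (f≈g n) (g≈h n)
                    }
                  ; ∙-cong = λ f≈f′ g≈g′ n → +-cong (f≈f′ n) (g≈g′ n)
                  }
                ; assoc = λ f g h n → +-assoc (f n) (g n) (h n)
                }
              ; identity =
                  (λ f n → trans (+-congʳ (0ₛ-zero n)) (+-identityˡ (f n)))
                , (λ f n → trans (+-congˡ (0ₛ-zero n)) (+-identityʳ (f n)))
              }
            ; inverse =
                (λ f n → trans (-‿inverseˡ (f n)) (sym (0ₛ-zero n)))
              , (λ f n → trans (-‿inverseʳ (f n)) (sym (0ₛ-zero n)))
            ; ⁻¹-cong = λ f≈g n → -‿cong (f≈g n)
            }
          ; comm = λ f g n → +-comm (f n) (g n)
          }
        ; *-cong = *ₛ-cong
        ; *-assoc = *ₛ-assoc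
        ; *-identity =
            *ₛ-identityˡ
          , (λ f n → trans (*ₛ-comm f 1ₛ n) (*ₛ-identityˡ f n))
        ; distrib =
            (λ f g h n → trans (*ₛ-comm f (g +ₛ h) n)
               (trans (*ₛ-distribʳ f g h n) (+-cong (*ₛ-comm g f n) (*ₛ-comm h f n))))
          , *ₛ-distribʳ
        }
      ; *-comm = *ₛ-comm
      }
    }

-- Moving list members to the front.

∈⇒↭∷ : ∀ {a} {A : Set a} {x : A} {xs} → x ∈ xs → ∃[ ys ] xs ↭ x ∷ ys
∈⇒↭∷ {x = x} x∈xs with ys , zs , ≡.refl ← ∈-∃++ x∈xs = _ , shift x ys zs

-- Brings two exponents r and s to the front, where `h-remove₂` can delete them. Distinctness
-- ensures that the second is still present once the first has been taken out.
∈-∈⇒↭∷∷ : ∀ {a} {A : Set a} {x y : A} {xs} → x ∈ xs → y ∈ xs → x ≢ y →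
  ∃[ zs ] xs ↭ x ∷ y ∷ zs
∈-∈⇒↭∷∷ x∈xs y∈xs x≢y with ys , xs↭ ← ∈⇒↭∷ x∈xs with ∈-resp-↭ xs↭ y∈xs
... | here y≡x   = contradiction (≡.sym y≡x) x≢y
... | there y∈ys with zs , ys↭ ← ∈⇒↭∷ y∈ys = zs , ↭-trans xs↭ (prep _ ys↭)

-- Gaussian binomials as complete homogeneous symmetric polynomials.

module GaussianBinomials {c ℓ} (R : CommutativeSemiring c ℓ)
  (Q : CommutativeSemiring.Carrier R) where

  open CommutativeSemiring R
  open import Algebra.Properties.CommutativeSemiring.Exp R
    using (_^_; ^-homo-*; ^-congˡ; ^-distrib-*)
  open import Relation.Binary.Reasoning.Setoid setoid
  open import Algebra.Solver.Ring.NaturalCoefficients.Default R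
    using (solve; _:+_; _:*_; _:=_)

  -- h n es is the coefficient of tⁿ in t / ∏ (1 - t Qᵉ) over e in es, a
  -- complete homogeneous symmetric polynomial of degree n - 1.
  h : ℕ → List ℕ → Carrier
  h zero          es       = 0#
  h (suc n)       (e ∷ es) = h (suc n) es + Q ^ e * h n (e ∷ es)
  h (suc zero)    []       = 1#
  h (suc (suc n)) []       = 0#

  -- The recursion singles out the head of the list, so symmetry needs an argument: after unfolding,
  -- induction applies at the two preceding values of n.
  h-swap : ∀ n e f es → h n (e ∷ f ∷ es) ≈ h n (f ∷ e ∷ es)
  h-swap zero          e f es = refl
  h-swap (suc zero)    e f es =
    solve 4 (λ x u v z → x :+ v :* z :+ u :* z := x :+ u :* z :+ v :* z) refl _ _ _ _
  h-swap (suc (suc n)) e f es = begin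
    h (2 ℕ.+ n) es + v * h (suc n) (f ∷ es) + u * (h (suc n) (f ∷ es) + u * h n (e ∷ f ∷ es))
      ≈⟨ solve 5 (λ x y z u v →
           x :+ v :* y :+ u :* (y :+ u :* z) := x :+ u :* (y :+ u :* z) :+ v :* y)
           refl _ _ _ _ _ ⟩
    h (2 ℕ.+ n) es + u * h (suc n) (e ∷ f ∷ es) + v * h (suc n) (f ∷ es)
      ≈⟨ +-congʳ (+-congˡ (*-congˡ (h-swap (suc n) e f es))) ⟩
    h (2 ℕ.+ n) es + u * (h (suc n) (e ∷ es) + v * h n (f ∷ e ∷ es)) + v * h (suc n) (f ∷ es)
      ≈⟨ solve 6 (λ x y z u v w →
           x :+ u :* (y :+ v :* z) :+ v :* w := x :+ u :* y :+ v :* (w :+ u :* z))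
           refl _ _ _ _ _ _ ⟩
    h (2 ℕ.+ n) es + u * h (suc n) (e ∷ es) + v * (h (suc n) (f ∷ es) + u * h n (f ∷ e ∷ es))
      ≈⟨ +-congˡ (*-congˡ (+-congˡ (*-congˡ (h-swap n e f es)))) ⟨
    h (2 ℕ.+ n) es + u * h (suc n) (e ∷ es) + v * h (suc n) (e ∷ f ∷ es)
      ≈⟨ +-congˡ (*-congˡ (h-swap (suc n) e f es)) ⟩
    h (2 ℕ.+ n) (f ∷ e ∷ es) ∎
    where
    u = Q ^ e
    v = Q ^ f

  -- The recursion is lexicographic in n and the derivation: the `swap` case calls itself on a
  -- larger derivation, but at a smaller n.
  h-resp-↭ : ∀ n {es fs} → es ↭ fs → h n es ≈ h n fs
  h-resp-↭ zero    es↭fs = refl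
  h-resp-↭ (suc n) _↭_.refl = refl
  h-resp-↭ (suc n) (prep e es↭fs) =
    +-cong (h-resp-↭ (suc n) es↭fs) (*-congˡ (h-resp-↭ n (prep e es↭fs)))
  h-resp-↭ (suc n) (swap e f es↭fs) = trans (h-swap (suc n) e f _)
    (+-cong (+-cong (h-resp-↭ (suc n) es↭fs) (*-congˡ (h-resp-↭ n (prep e es↭fs))))
            (*-congˡ (h-resp-↭ n (prep f (prep e es↭fs)))))
  h-resp-↭ (suc n) (_↭_.trans es↭fs fs↭gs) =
    trans (h-resp-↭ (suc n) es↭fs) (h-resp-↭ (suc n) fs↭gs)

  -- h n (r ∷ es) - Q^r h (n - 1) (r ∷ es) = h n es, applied to r and then to
  -- s, without subtraction.
  h-remove₂ : ∀ n r s es → let fs = r ∷ s ∷ es in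
    h (2 ℕ.+ n) fs + Q ^ r * Q ^ s * h n fs
      ≈ h (2 ℕ.+ n) es + (Q ^ r + Q ^ s) * h (suc n) fs
  h-remove₂ n r s es =
    solve 5 (λ x y z u v →
      x :+ v :* y :+ u :* (y :+ u :* z) :+ u :* v :* z := x :+ (u :+ v) :* (y :+ u :* z))
      refl _ _ _ _ _

  -- The argument n is shifted by one: binomial⁻ n k is the Gaussian
  -- binomial [n - 1, k] in base Q, so that no truncation occurs at n = 0.
  binomial⁻ : ℕ → ℕ → Carrier
  binomial⁻ n k = h (n ∸ k) (downFrom (suc k))

  binomial : ℕ → ℕ → Carrier
  binomial n = binomial⁻ (suc n)

  -- Separates honest subtraction from truncation. In the truncated case both degrees are 0, where
  -- `h` vanishes.
  suc-∸ : ∀ n k → suc n ∸ k ≡ suc (n ∸ k) ⊎ (suc n ∸ k ≡ 0 × n ∸ k ≡ 0)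
  suc-∸ n k with k ℕ.≤? n
  ... | yes k≤n = inj₁ (ℕ.+-∸-assoc 1 k≤n)
  ... | no  k≰n = inj₂ (ℕ.m≤n⇒m∸n≡0 (ℕ.≰⇒> k≰n) , ℕ.m≤n⇒m∸n≡0 (ℕ.≰⇒≥ k≰n))

  binomial-zeroʳ : ∀ n → binomial n 0 ≈ 1#
  binomial-zeroʳ zero    = trans (+-congˡ (zeroʳ _)) (+-identityʳ 1#)
  binomial-zeroʳ (suc n) =
    trans (+-cong refl (trans (*-identityˡ _) (binomial-zeroʳ n))) (+-identityˡ 1#)

  -- The q-Pascal rule. The head of `downFrom (2 ℕ.+ k)` is `suc k`, so without truncation this is
  -- the defining recursion of `h`.
  binomial-suc : ∀ n k →
    binomial (suc n) (suc k) ≈ binomial n k + Q ^ suc k * binomial n (suc k)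
  binomial-suc n k with suc n ∸ k | n ∸ k | suc-∸ n k
  ... | _ | _ | inj₁ ≡.refl            = refl
  ... | _ | _ | inj₂ (≡.refl , ≡.refl) = sym (trans (+-identityˡ _) (zeroʳ _))

  -- The exponent k (k - 1) / 2 of the q-binomial theorem.
  triangle : ℕ → ℕ
  triangle zero    = 0
  triangle (suc k) = k ℕ.+ triangle k

  -- By the q-binomial theorem, the coefficient of zᵏ in ∏ (1 + x Qʲ z) over
  -- j < n.
  elementary : Carrier → ℕ → ℕ → Carrier
  elementary x n k = x ^ k * (Q ^ triangle k * binomial n k)

  elementary-zeroˡ : ∀ x k → elementary x 0 (suc k) ≈ 0#
  elementary-zeroˡ x k rewrite ℕ.0∸n≡0 k = trans (*-congˡ (zeroʳ _)) (zeroʳ _)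

  elementary-zeroʳ : ∀ x n → elementary x n 0 ≈ 1#
  elementary-zeroʳ x n = trans (*-identityˡ _) (trans (*-identityˡ _) (binomial-zeroʳ n))

  -- Reflects splitting off the factor 1 + x z with j = 0; the remaining factors are those for x Q
  -- in place of x.
  elementary-suc : ∀ x n k → elementary x (suc n) (suc k)
    ≈ elementary (x * Q) n (suc k) + x * elementary (x * Q) n k
  elementary-suc x n k = begin
    x * x ^ k * (Q ^ (k ℕ.+ triangle k) * binomial (suc n) (suc k))
      ≈⟨ *-congˡ (*-cong (^-homo-* Q k _) (binomial-suc n k)) ⟩
    x * x ^ k * (Q ^ k * Q ^ triangle k * (binomial n k + Q * Q ^ k * binomial n (suc k)))
      ≈⟨ solve 7 (λ x xᵏ Q Qᵏ Qᵗ b b′ →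
           x :* xᵏ :* (Qᵏ :* Qᵗ :* (b :+ Q :* Qᵏ :* b′))
             := x :* Q :* (xᵏ :* Qᵏ) :* (Qᵏ :* Qᵗ :* b′) :+ x :* (xᵏ :* Qᵏ :* (Qᵗ :* b)))
           refl x _ Q _ _ _ _ ⟩
    x * Q * (x ^ k * Q ^ k) * (Q ^ k * Q ^ triangle k * binomial n (suc k))
      + x * (x ^ k * Q ^ k * (Q ^ triangle k * binomial n k))
      ≈⟨ +-cong (*-cong (*-congˡ (^-distrib-* x Q k)) (*-congʳ (^-homo-* Q k _)))
                (*-congˡ (*-congʳ (^-distrib-* x Q k))) ⟨
    elementary (x * Q) n (suc k) + x * elementary (x * Q) n k ∎

  -- `x ^ k` and `x′ ^ k` combine to `Q ^ k`, so the prefactor depends on k, l and Q alone and is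
  -- common to the a-terms and the b-terms.
  elementary-* : ∀ {x x′} → x * x′ ≈ Q → ∀ m n k l →
    elementary x m (k ℕ.+ l) * elementary x′ n k
      ≈ Q ^ k * (Q ^ triangle (k ℕ.+ l) * Q ^ triangle k)
          * (x ^ l * (binomial m (k ℕ.+ l) * binomial n k))
  elementary-* {x} {x′} xx′≈Q m n k l = begin
    elementary x m (k ℕ.+ l) * elementary x′ n k
      ≈⟨ *-congʳ (*-congʳ (^-homo-* x k l)) ⟩
    x ^ k * x ^ l * (Q ^ triangle (k ℕ.+ l) * binomial m (k ℕ.+ l))
      * (x′ ^ k * (Q ^ triangle k * binomial n k))
      ≈⟨ solve 7 (λ xᵏ xˡ u b x′ᵏ v c →
           xᵏ :* xˡ :* (u :* b) :* (x′ᵏ :* (v :* c))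
             := xᵏ :* x′ᵏ :* (u :* v) :* (xˡ :* (b :* c)))
           refl _ _ _ _ _ _ _ ⟩
    x ^ k * x′ ^ k * (Q ^ triangle (k ℕ.+ l) * Q ^ triangle k)
      * (x ^ l * (binomial m (k ℕ.+ l) * binomial n k))
      ≈⟨ *-congʳ (*-congʳ (trans (sym (^-distrib-* x x′ k)) (^-congˡ k xx′≈Q))) ⟩
    _ ∎

-- Subsemirings and the order they induce.

record IsSubsemiring {c ℓ p} (R : CommutativeSemiring c ℓ)
  (P : CommutativeSemiring.Carrier R → Set p) : Set (c ⊔ ℓ ⊔ p) where
  open CommutativeSemiring R
  field
    resp     : ∀ {x y} → x ≈ y → P x → P y
    0-closed : P 0#
    1-closed : P 1#
    +-closed : ∀ {x y} → P x → P y → P (x + y)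
    *-closed : ∀ {x y} → P x → P y → P (x * y)

-- Used for two subsemirings of ℤ⟦q⟧: the series with nonnegative coefficients, and the series in
-- q^M.
module SubsemiringProperties {c ℓ p} {R : CommutativeSemiring c ℓ}
  {P : CommutativeSemiring.Carrier R → Set p} (isSubsemiring : IsSubsemiring R P)
  {Q : CommutativeSemiring.Carrier R} (Q∈P : P Q) where

  open CommutativeSemiring R
  open IsSubsemiring isSubsemiring
  open import Algebra.Properties.CommutativeSemiring.Exp R using (_^_)
  open import Algebra.Solver.Ring.NaturalCoefficients.Default R using (solve; _:+_; _:*_; _:=_)
  open import Relation.Binary.Reasoning.Setoid setoid
  open GaussianBinomials R Q

  ^-closed : ∀ {x} → P x → ∀ n → P (x ^ n)
  ^-closed x∈P zero    = 1-closed
  ^-closed x∈P (suc n) = *-closed x∈P (^-closed x∈P n)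

  h-closed : ∀ n es → P (h n es)
  h-closed zero          es       = 0-closed
  h-closed (suc n)       (e ∷ es) =
    +-closed (h-closed (suc n) es) (*-closed (^-closed Q∈P e) (h-closed n (e ∷ es)))
  h-closed (suc zero)    []       = 1-closed
  h-closed (suc (suc n)) []       = 0-closed

  binomial⁻-closed : ∀ n k → P (binomial⁻ n k)
  binomial⁻-closed n k = h-closed (n ∸ k) (downFrom (suc k))

  elementary-closed : ∀ {x} → P x → ∀ n k → P (elementary x n k)
  elementary-closed x∈P n k =
    *-closed (^-closed x∈P k) (*-closed (^-closed Q∈P (triangle k)) (binomial⁻-closed (suc n) k))

  -- A semiring has no subtraction, so an inequality carries its difference as a witness.
  infix 4 _≼_
  _≼_ : Carrier → Carrier → Set _
  x ≼ y = ∃[ z ] P z × y ≈ x + z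

  ≼-respˡ : ∀ {x y z} → x ≈ y → x ≼ z → y ≼ z
  ≼-respˡ x≈y (d , d∈P , z≈) = d , d∈P , trans z≈ (+-congʳ x≈y)

  ≼-respʳ : ∀ {x y z} → y ≈ z → x ≼ y → x ≼ z
  ≼-respʳ y≈z (d , d∈P , y≈) = d , d∈P , trans (sym y≈z) y≈

  ≼-reflexive : ∀ {x y} → x ≈ y → x ≼ y
  ≼-reflexive x≈y = 0# , 0-closed , trans (sym x≈y) (sym (+-identityʳ _))

  ≼-refl : ∀ {x} → x ≼ x
  ≼-refl = ≼-reflexive refl

  ≼-trans : ∀ {x y z} → x ≼ y → y ≼ z → x ≼ z
  ≼-trans (d , d∈P , y≈) (e , e∈P , z≈) =
    d + e , +-closed d∈P e∈P , trans z≈ (trans (+-congʳ y≈) (+-assoc _ _ _))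

  0≼ : ∀ {x} → P x → 0# ≼ x
  0≼ {x} x∈P = x , x∈P , sym (+-identityˡ x)

  +-mono-≼ : ∀ {x y u v} → x ≼ y → u ≼ v → x + u ≼ y + v
  +-mono-≼ (d , d∈P , y≈) (e , e∈P , v≈) = d + e , +-closed d∈P e∈P ,
    trans (+-cong y≈ v≈)
      (solve 4 (λ x d u e → (x :+ d) :+ (u :+ e) := (x :+ u) :+ (d :+ e)) refl _ _ _ _)

  *-monoʳ-≼ : ∀ {x y z} → P z → x ≼ y → z * x ≼ z * y
  *-monoʳ-≼ {z = z} z∈P (d , d∈P , y≈) =
    z * d , *-closed z∈P d∈P , trans (*-congˡ y≈) (distribˡ z _ d)

  *-mono-≼ : ∀ {x y u v} → P x → P v → x ≼ y → u ≼ v → x * u ≼ y * v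
  *-mono-≼ x∈P v∈P x≼y u≼v = ≼-trans (*-monoʳ-≼ x∈P u≼v)
    (≼-respˡ (*-comm _ _) (≼-respʳ (*-comm _ _) (*-monoʳ-≼ v∈P x≼y)))

  -- The exponent 0 contributes the variable 1, so consecutive values of `h` differ by `h` with that
  -- variable deleted.
  binomial⁻-mono : ∀ n k → binomial⁻ n k ≼ binomial⁻ (suc n) k
  binomial⁻-mono n k with suc n ∸ k | n ∸ k | suc-∸ n k
  ... | _ | m | inj₁ ≡.refl with es , perm ← ∈⇒↭∷ (∈-downFrom⁺ {suc k} (s≤s z≤n)) =
    h (suc m) es , h-closed (suc m) es , (begin
      h (suc m) (downFrom (suc k))           ≈⟨ h-resp-↭ (suc m) perm ⟩
      h (suc m) es + 1# * h m (0 ∷ es)       ≈⟨ +-comm _ _ ⟩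
      1# * h m (0 ∷ es) + h (suc m) es       ≈⟨ +-congʳ (*-identityˡ _) ⟩
      h m (0 ∷ es) + h (suc m) es            ≈⟨ +-congʳ (h-resp-↭ m perm) ⟨
      h m (downFrom (suc k)) + h (suc m) es  ∎)
  ... | _ | _ | inj₂ (≡.refl , ≡.refl) = ≼-refl

  -- For k ≤ n, `h-remove₂` exhibits the difference as `h` over the exponents 0, ..., k other than r
  -- and s. For k > n the left side is zero.
  binomial⁻-convex : ∀ n k {r s} → r ≢ s → r ≤ k → s ≤ k →
    (Q ^ r + Q ^ s) * binomial⁻ (1 ℕ.+ n) k
      ≼ binomial⁻ (2 ℕ.+ n) k + Q ^ r * Q ^ s * binomial⁻ n k
  binomial⁻-convex n k {r} {s} r≢s r≤k s≤k with k ℕ.≤? n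
  ... | no k≰n rewrite ℕ.m≤n⇒m∸n≡0 (ℕ.≰⇒> k≰n) = ≼-respˡ (sym (zeroʳ _))
    (0≼ (+-closed (binomial⁻-closed (2 ℕ.+ n) k)
      (*-closed (*-closed (^-closed Q∈P r) (^-closed Q∈P s)) (binomial⁻-closed n k))))
  ... | yes k≤n rewrite ℕ.+-∸-assoc 2 k≤n | ℕ.+-∸-assoc 1 k≤n
    with es , perm ← ∈-∈⇒↭∷∷ (∈-downFrom⁺ (s≤s r≤k)) (∈-downFrom⁺ (s≤s s≤k)) r≢s =
    h (2 ℕ.+ m) es , h-closed (2 ℕ.+ m) es , (begin
      h (2 ℕ.+ m) fs + Q ^ r * Q ^ s * h m fs
        ≈⟨ +-cong (h-resp-↭ (2 ℕ.+ m) perm) (*-congˡ (h-resp-↭ m perm)) ⟩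
      h (2 ℕ.+ m) gs + Q ^ r * Q ^ s * h m gs
        ≈⟨ h-remove₂ m r s es ⟩
      h (2 ℕ.+ m) es + (Q ^ r + Q ^ s) * h (suc m) gs
        ≈⟨ +-comm _ _ ⟩
      (Q ^ r + Q ^ s) * h (suc m) gs + h (2 ℕ.+ m) es
        ≈⟨ +-congʳ (*-congˡ (h-resp-↭ (suc m) perm)) ⟨
      (Q ^ r + Q ^ s) * h (suc m) fs + h (2 ℕ.+ m) es ∎)
    where
    m  = n ∸ k
    fs = downFrom (suc k)
    gs = r ∷ s ∷ es

  -- The convexity above leaves [n - 1, k] [n, l] uncovered, which is at most
  -- [n, k] [n + 1, l] by monotonicity.
  binomial-*-≼ : ∀ n k l {r s} → r ≢ s → r ≤ k → s ≤ k →
    (Q ^ r + Q ^ s) * (binomial n k * binomial n l)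
      ≼ binomial (suc n) k * binomial n l
          + Q ^ r * Q ^ s * (binomial n k * binomial (suc n) l)
  binomial-*-≼ n k l {r} {s} r≢s r≤k s≤k = ≼-trans
    (≼-respˡ (solve 3 (λ w b c → c :* (w :* b) := w :* (b :* c)) refl _ _ _)
      (≼-respʳ (solve 4 (λ c d w b → c :* (d :+ w :* b) := d :* c :+ w :* (b :* c)) refl _ _ _ _)
        (*-monoʳ-≼ (binomial⁻-closed (suc n) l) (binomial⁻-convex n k r≢s r≤k s≤k))))
    (+-mono-≼ ≼-refl
      (*-monoʳ-≼ (*-closed (^-closed Q∈P r) (^-closed Q∈P s))
        (*-mono-≼ (binomial⁻-closed n k) (binomial⁻-closed (2 ℕ.+ n) l)
          (binomial⁻-mono n k) (binomial⁻-mono (suc n) l))))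

  binomial-square-≼ : ∀ n k →
    (1# + 1#) * (binomial n k * binomial n k)
      ≼ binomial (suc n) k * binomial n k
          + 1# * 1# * (binomial n k * binomial (suc n) k)
  binomial-square-≼ n k =
    ≼-respˡ (trans (sym (+-cong (*-identityˡ _) (*-identityˡ _))) (sym (distribʳ _ 1# 1#)))
      (+-mono-≼ (*-mono-≼ b∈P b∈P mono ≼-refl)
        (≼-respʳ (sym (trans (*-congʳ (*-identityˡ 1#)) (*-identityˡ _)))
          (*-monoʳ-≼ b∈P mono)))
    where
    b∈P  = binomial⁻-closed (suc n) k
    mono = binomial⁻-mono (suc n) k

  -- With x = qᵃ, x′ = q^(M - a), y = qᵇ, y′ = q^(M - b) and Q = q^M, the
  -- two sides are the coefficients belonging to k + l and k parts in the two
  -- residue classes; the hypotheses say r = l (b - a) / M and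
  -- s = l (M - a - b) / M.
  elementary-≼ : ∀ {x x′ y y′} → P x → x * x′ ≈ Q → y * y′ ≈ Q →
    ∀ n k l {r s} → (l ≡ 0 × r ≡ 0 × s ≡ 0) ⊎ (r ≢ s × r ≤ l × s ≤ l) →
    x ^ l * Q ^ r ≈ y ^ l → x ^ l * Q ^ s ≈ y′ ^ l → x ^ l * (Q ^ r * Q ^ s) ≈ x′ ^ l →
    elementary y n (k ℕ.+ l) * elementary y′ n k
      + elementary y′ n (k ℕ.+ l) * elementary y n k
    ≼ elementary x (suc n) (k ℕ.+ l) * elementary x′ n k
      + elementary x′ n (k ℕ.+ l) * elementary x (suc n) k
  elementary-≼ {x} {x′} {y} {y′} x∈P xx′≈Q yy′≈Q n k l {r} {s} cases eqʳ eqˢ eqʳˢ =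
    ≼-respˡ (sym lhs) (≼-respʳ (sym rhs)
      (*-monoʳ-≼ (*-closed w∈P (^-closed x∈P l)) (inequality cases)))
    where
    w = Q ^ k * (Q ^ triangle (k ℕ.+ l) * Q ^ triangle k)
    w∈P : P w
    w∈P = *-closed (^-closed Q∈P k)
      (*-closed (^-closed Q∈P (triangle (k ℕ.+ l))) (^-closed Q∈P (triangle k)))
    b = binomial n (k ℕ.+ l) * binomial n k
    b₁ = binomial (suc n) (k ℕ.+ l) * binomial n k
    b₂ = binomial n (k ℕ.+ l) * binomial (suc n) k

    inequality : (l ≡ 0 × r ≡ 0 × s ≡ 0) ⊎ (r ≢ s × r ≤ l × s ≤ l) →
      (Q ^ r + Q ^ s) * b ≼ b₁ + Q ^ r * Q ^ s * b₂
    inequality (inj₁ (≡.refl , ≡.refl , ≡.refl)) rewrite ℕ.+-identityʳ k = binomial-square-≼ n k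
    inequality (inj₂ (r≢s , r≤l , s≤l)) =
      binomial-*-≼ n (k ℕ.+ l) k r≢s (ℕ.m≤n⇒m≤o+n k r≤l) (ℕ.m≤n⇒m≤o+n k s≤l)

    lhs : elementary y n (k ℕ.+ l) * elementary y′ n k
            + elementary y′ n (k ℕ.+ l) * elementary y n k
          ≈ w * x ^ l * ((Q ^ r + Q ^ s) * b)
    lhs = begin
      _ ≈⟨ +-cong (elementary-* yy′≈Q n n k l)
                  (elementary-* (trans (*-comm y′ y) yy′≈Q) n n k l) ⟩
      w * (y ^ l * b) + w * (y′ ^ l * b)
        ≈⟨ +-cong (*-congˡ (*-congʳ eqʳ)) (*-congˡ (*-congʳ eqˢ)) ⟨
      w * (x ^ l * Q ^ r * b) + w * (x ^ l * Q ^ s * b)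
        ≈⟨ solve 5 (λ w xˡ Qʳ Qˢ b → w :* (xˡ :* Qʳ :* b) :+ w :* (xˡ :* Qˢ :* b)
             := w :* xˡ :* ((Qʳ :+ Qˢ) :* b)) refl w _ _ _ _ ⟩
      w * x ^ l * ((Q ^ r + Q ^ s) * b) ∎

    rhs : elementary x (suc n) (k ℕ.+ l) * elementary x′ n k
            + elementary x′ n (k ℕ.+ l) * elementary x (suc n) k
          ≈ w * x ^ l * (b₁ + Q ^ r * Q ^ s * b₂)
    rhs = begin
      _ ≈⟨ +-cong (elementary-* xx′≈Q (suc n) n k l)
                  (elementary-* (trans (*-comm x′ x) xx′≈Q) n (suc n) k l) ⟩
      w * (x ^ l * b₁) + w * (x′ ^ l * b₂)
        ≈⟨ +-congˡ (*-congˡ (*-congʳ eqʳˢ)) ⟨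
      w * (x ^ l * b₁) + w * (x ^ l * (Q ^ r * Q ^ s) * b₂)
        ≈⟨ solve 6 (λ w xˡ Qʳ Qˢ b₁ b₂ → w :* (xˡ :* b₁) :+ w :* (xˡ :* (Qʳ :* Qˢ) :* b₂)
             := w :* xˡ :* (b₁ :+ Qʳ :* Qˢ :* b₂)) refl w _ _ _ _ _ ⟩
      w * x ^ l * (b₁ + Q ^ r * Q ^ s * b₂) ∎

-- The q-binomial theorem for the products of the statement.

module PochhammerCoefficients {c ℓ} (R : CommutativeRing c ℓ)
  (y : CommutativeRing.Carrier R) (M : ℕ) where

  open CommutativeRing R
  open PowerSeries rawRing using (Series; const; X)
  open PowerSeriesProperties R
  open CommutativeRing commutativeRing using ()
    renaming (_≈_ to _≈ₛ_; _+_ to _+ₛ_; _*_ to _*ₛ_; -_ to -ₛ_; 1# to 1ₛ)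
  module S = CommutativeRing commutativeRing
  open import Algebra.Properties.CommutativeSemiring.Exp commutativeSemiring
    using (_^_; ^-homo-*; ^-assocʳ)
  open import Algebra.Properties.CommutativeSemiring.Exp S.commutativeSemiring
    using () renaming (_^_ to _^ₛ_; ^-congˡ to ^ₛ-congˡ)
  open import Algebra.Properties.Ring S.ring using (-‿distribˡ-*; -‿involutive)
  open import Algebra.Properties.CommutativeMonoid.Sum S.*-commutativeMonoid
    using ()
    renaming (sum to product; sum-cong-≋ to product-cong; sum-init-last to product-init-last)
  open QPochhammer S.rawRing using (⟨_⨾_⟩_)
  open GaussianBinomials commutativeSemiring (y ^ M)

  private
    Q = y ^ M

  const-cong : ∀ {x x′} → x ≈ x′ → const x ≈ₛ const x′
  const-cong x≈ zero    = x≈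
  const-cong x≈ (suc n) = refl

  const-* : ∀ x x′ → const (x * x′) ≈ₛ const x *ₛ const x′
  const-* x x′ zero    = sym (const-*ₛ x (const x′) 0)
  const-* x x′ (suc n) = sym (trans (const-*ₛ x (const x′) (suc n)) (zeroʳ x))

  const-^ : ∀ x n → const (x ^ n) ≈ₛ const x ^ₛ n
  const-^ x zero    = S.refl
  const-^ x (suc n) = S.trans (const-* x (x ^ n)) (S.*-congˡ {const x} (const-^ x n))

  linear : Carrier → Series
  linear x = 1ₛ +ₛ X *ₛ const x

  linear-cong : ∀ {x x′} → x ≈ x′ → linear x ≈ₛ linear x′
  linear-cong x≈ = S.+-congˡ {1ₛ} (S.*-congˡ {X} (const-cong x≈))

  linear-*-zero : ∀ x f → (linear x *ₛ f) 0 ≈ f 0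
  linear-*-zero x f = begin
    (linear x *ₛ f) 0
      ≈⟨ +-identityʳ _ ⟩
    (1# + (X *ₛ const x) 0) * f 0
      ≈⟨ *-congʳ (+-congˡ (X-*ₛ-zero (const x))) ⟩
    (1# + 0#) * f 0
      ≈⟨ trans (*-congʳ (+-identityʳ 1#)) (*-identityˡ _) ⟩
    f 0 ∎
    where open import Relation.Binary.Reasoning.Setoid setoid

  linear-*-suc : ∀ x f n → (linear x *ₛ f) (suc n) ≈ f (suc n) + x * f n
  linear-*-suc x f n = begin
    (linear x *ₛ f) (suc n)
      ≈⟨ S.distribʳ f 1ₛ (X *ₛ const x) (suc n) ⟩
    (1ₛ *ₛ f) (suc n) + (X *ₛ const x *ₛ f) (suc n)
      ≈⟨ +-cong (S.*-identityˡ f (suc n)) (S.*-assoc X (const x) f (suc n)) ⟩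
    f (suc n) + (X *ₛ (const x *ₛ f)) (suc n)
      ≈⟨ +-congˡ (trans (X-*ₛ-suc (const x *ₛ f) n) (const-*ₛ x f n)) ⟩
    f (suc n) + x * f n ∎
    where open import Relation.Binary.Reasoning.Setoid setoid

  -- The q-binomial theorem by induction on n, passing from x to x Q. The factors are prescribed
  -- only up to `≈ₛ`, so that the shifted family is again an instance.
  product-linear : ∀ n x (t : Fin n → Series) →
    (∀ j → t j ≈ₛ linear (x * Q ^ toℕ j)) → product t ≈ₛ elementary x n
  product-linear zero x t t≈ zero    = sym (elementary-zeroʳ x 0)
  product-linear zero x t t≈ (suc k) = sym (elementary-zeroˡ x k)
  product-linear (suc n) x t t≈ k = begin
    product t k
      ≈⟨ S.*-cong (S.trans (t≈ fzero) (linear-cong (*-identityʳ x)))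
           (product-linear n (x * Q) (λ j → t (fsuc j))
             λ j → S.trans (t≈ (fsuc j)) (linear-cong (sym (*-assoc x Q _)))) k ⟩
    (linear x *ₛ elementary (x * Q) n) k
      ≈⟨ step k ⟩
    elementary x (suc n) k ∎
    where
    open import Relation.Binary.Reasoning.Setoid setoid
    step : linear x *ₛ elementary (x * Q) n ≈ₛ elementary x (suc n)
    step zero    = trans (linear-*-zero x (elementary (x * Q) n))
      (trans (elementary-zeroʳ (x * Q) n) (sym (elementary-zeroʳ x (suc n))))
    step (suc k) = trans (linear-*-suc x (elementary (x * Q) n) k) (sym (elementary-suc x n k))

  -- Has the shape to which `⟨_⨾_⟩_` unfolds, double negation included, so that `pochhammer` is its
  -- product by computation.
  factor : ℕ → ℕ → Series
  factor s j = 1ₛ +ₛ -ₛ (-ₛ (X *ₛ const y ^ₛ s) *ₛ (const y ^ₛ M) ^ₛ j)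

  factor-linear : ∀ s j → factor s j ≈ₛ linear (y ^ s * Q ^ j)
  factor-linear s j = S.+-congˡ {1ₛ} (begin
    -ₛ (-ₛ (X *ₛ const y ^ₛ s) *ₛ (const y ^ₛ M) ^ₛ j)
      ≈⟨ -‿distribˡ-* (-ₛ (X *ₛ const y ^ₛ s)) ((const y ^ₛ M) ^ₛ j) ⟩
    -ₛ -ₛ (X *ₛ const y ^ₛ s) *ₛ (const y ^ₛ M) ^ₛ j
      ≈⟨ S.*-congʳ {(const y ^ₛ M) ^ₛ j} (-‿involutive (X *ₛ const y ^ₛ s)) ⟩
    X *ₛ const y ^ₛ s *ₛ (const y ^ₛ M) ^ₛ j
      ≈⟨ S.*-assoc X (const y ^ₛ s) ((const y ^ₛ M) ^ₛ j) ⟩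
    X *ₛ (const y ^ₛ s *ₛ (const y ^ₛ M) ^ₛ j)
      ≈⟨ S.*-congˡ {X} (S.*-cong (const-^ y s)
           (S.trans (const-^ Q j) (^ₛ-congˡ j (const-^ y M)))) ⟨
    X *ₛ (const (y ^ s) *ₛ const (Q ^ j))
      ≈⟨ S.*-congˡ {X} (const-* (y ^ s) (Q ^ j)) ⟨
    X *ₛ const (y ^ s * Q ^ j) ∎)
    where open import Relation.Binary.Reasoning.Setoid S.setoid

  pochhammer : ℕ → ℕ → Series
  pochhammer s n = ⟨ -ₛ (X *ₛ const y ^ₛ s) ⨾ const y ^ₛ M ⟩ n

  pochhammer-coefficients : ∀ s n → pochhammer s n ≈ₛ elementary (y ^ s) n
  pochhammer-coefficients s n =
    product-linear n (y ^ s) (λ j → factor s (toℕ j)) (λ j → factor-linear s (toℕ j))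

  lastFactor : ℕ → ℕ → Series
  lastFactor s n = 1ₛ +ₛ X *ₛ const y ^ₛ (n ℕ.* M ℕ.+ s)

  -- The additional factor is the one of index n, so it lengthens the product by one.
  pochhammer-extend-coefficients : ∀ s n →
    pochhammer s n *ₛ lastFactor s n
      ≈ₛ elementary (y ^ s) (suc n)
  pochhammer-extend-coefficients s n = begin
    pochhammer s n *ₛ lastFactor s n
      ≈⟨ S.*-cong
           (product-cong {n} (λ i → S.reflexive (≡.cong (factor s) (≡.sym (toℕ-inject₁ i)))))
           (S.trans
             (S.+-congˡ {1ₛ} (S.*-congˡ {X}
               (S.trans (S.sym (const-^ y (n ℕ.* M ℕ.+ s))) (const-cong exponent))))
             (S.sym (factor-linear s (toℕ (fromℕ n))))) ⟩
    product {n} (λ i → factor s (toℕ (inject₁ i))) *ₛ factor s (toℕ (fromℕ n))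
      ≈⟨ product-init-last {n} (λ j → factor s (toℕ j)) ⟨
    product {suc n} (λ j → factor s (toℕ j))
      ≈⟨ pochhammer-coefficients s (suc n) ⟩
    elementary (y ^ s) (suc n) ∎
    where
    open import Relation.Binary.Reasoning.Setoid S.setoid
    exponent : y ^ (n ℕ.* M ℕ.+ s) ≈ y ^ s * Q ^ toℕ (fromℕ n)
    exponent rewrite toℕ-fromℕ n | ℕ.*-comm n M =
      trans (^-homo-* y (M ℕ.* n) s)
        (trans (*-comm _ _) (*-congˡ (sym (^-assocʳ y M n))))

  pochhammer-*-coefficients : ∀ s s′ n →
    pochhammer s n *ₛ pochhammer s′ n
      ≈ₛ elementary (y ^ s) n *ₛ elementary (y ^ s′) n
  pochhammer-*-coefficients s s′ n =
    S.*-cong (pochhammer-coefficients s n) (pochhammer-coefficients s′ n)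

  pochhammer-*-extend-coefficients : ∀ s s′ n →
    (pochhammer s n *ₛ pochhammer s′ n)
      *ₛ lastFactor s n
      ≈ₛ elementary (y ^ s) (suc n) *ₛ elementary (y ^ s′) n
  pochhammer-*-extend-coefficients s s′ n = begin
    (p *ₛ p′) *ₛ last  ≈⟨ S.*-assoc p p′ last ⟩
    p *ₛ (p′ *ₛ last)  ≈⟨ S.*-congˡ {p} (S.*-comm p′ last) ⟩
    p *ₛ (last *ₛ p′)  ≈⟨ S.*-assoc p last p′ ⟨
    (p *ₛ last) *ₛ p′
      ≈⟨ S.*-cong (pochhammer-extend-coefficients s n) (pochhammer-coefficients s′ n) ⟩
    elementary (y ^ s) (suc n) *ₛ elementary (y ^ s′) n ∎
    where
    open import Relation.Binary.Reasoning.Setoid S.setoid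
    p    = pochhammer s n
    p′   = pochhammer s′ n
    last = lastFactor s n

-- Specialization to ℤ⟦q⟧ and nonnegativity of coefficients.

open import Data.Nat.Base using (_+_; _*_)

ℤ⟦q⟧-commutativeRing : CommutativeRing _ _
ℤ⟦q⟧-commutativeRing = PowerSeriesProperties.commutativeRing ℤ.+-*-commutativeRing

ℤ⟦q,z⟧-commutativeRing : CommutativeRing _ _
ℤ⟦q,z⟧-commutativeRing = PowerSeriesProperties.commutativeRing ℤ⟦q⟧-commutativeRing

module K = CommutativeRing ℤ⟦q⟧-commutativeRing
module K⟦z⟧ = CommutativeRing ℤ⟦q,z⟧-commutativeRing
open import Algebra.Properties.CommutativeSemiring.Exp K.commutativeSemiring
  using (^-homo-*; ^-assocʳ) renaming (_^_ to _^ᴷ_)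
open import Algebra.Properties.CommutativeSemigroup ℤ.+-commutativeSemigroup using (interchange)
open import Algebra.Definitions.RawMonoid ℤ.+-0-rawMonoid using (sum)
open import Algebra.Definitions.RawMonoid K.+-rawMonoid using () renaming (sum to sumᴷ)
open PowerSeriesProperties ℤ.+-*-commutativeRing using (0ₛ-zero)

sum-closed : ∀ {p} (P : ℤ → Set p) → P 0ℤ → (∀ {x y} → P x → P y → P (x ℤ.+ y)) →
  ∀ n (t : Fin n → ℤ) → (∀ i → P (t i)) → P (sum t)
sum-closed P 0∈P +∈P zero    t t∈P = 0∈P
sum-closed P 0∈P +∈P (suc n) t t∈P =
  +∈P (t∈P fzero) (sum-closed P 0∈P +∈P n (λ i → t (fsuc i)) (λ i → t∈P (fsuc i)))

Nonneg : K.Carrier → Set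
Nonneg f = ∀ n → 0ℤ ≤ℤ f n

*-nonneg : ∀ {x y} → 0ℤ ≤ℤ x → 0ℤ ≤ℤ y → 0ℤ ≤ℤ x ℤ.* y
*-nonneg {x} {y} 0≤x 0≤y = ≡.subst (_≤ℤ x ℤ.* y) (ℤ.*-zeroʳ x)
  (ℤ.*-monoˡ-≤-nonNeg x {{ℤ.nonNegative 0≤x}} 0≤y)

Nonneg-isSubsemiring : IsSubsemiring K.commutativeSemiring Nonneg
Nonneg-isSubsemiring = record
  { resp     = λ f≈g 0≤f n → ≡.subst (0ℤ ≤ℤ_) (f≈g n) (0≤f n)
  ; 0-closed = λ n → ℤ.≤-reflexive (≡.sym (0ₛ-zero n))
  ; 1-closed = λ { zero → ℤ.+≤+ z≤n ; (suc n) → ℤ.≤-refl }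
  ; +-closed = λ 0≤f 0≤g n → ℤ.+-mono-≤ (0≤f n) (0≤g n)
  ; *-closed = λ {f} {g} 0≤f 0≤g n →
      sum-closed (0ℤ ≤ℤ_) ℤ.≤-refl ℤ.+-mono-≤ (suc n) (λ i → f (toℕ i) ℤ.* g (n ∸ toℕ i))
        λ i → *-nonneg (0≤f (toℕ i)) (0≤g (n ∸ toℕ i))
  }

X-nonneg : Nonneg ℤ⟦q⟧.X
X-nonneg zero          = ℤ.≤-refl
X-nonneg (suc zero)    = ℤ.+≤+ z≤n
X-nonneg (suc (suc n)) = ℤ.≤-refl

-- Residues modulo M of the exponents that occur in a series.

module Support (M : ℕ) where
  ZeroOr : Set → ℤ → Set
  ZeroOr C x = x ≡ 0ℤ ⊎ C

  -- Membership in q^k ℤ⟦q^M⟧, put as a disjunction for each coefficient so that sums and products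
  -- can be treated by cases.
  SupportedIn : ℕ → K.Carrier → Set
  SupportedIn k f = ∀ n → ZeroOr (∃[ t ] n ≡ k + t * M) (f n)

  ZeroOr-+ : ∀ {C x y} → ZeroOr C x → ZeroOr C y → ZeroOr C (x ℤ.+ y)
  ZeroOr-+ (inj₁ ≡.refl) (inj₁ ≡.refl) = inj₁ ≡.refl
  ZeroOr-+ (inj₁ _)      (inj₂ c)      = inj₂ c
  ZeroOr-+ (inj₂ c)      _             = inj₂ c

  support-* : ∀ {k l f g} → SupportedIn k f → SupportedIn l g → SupportedIn (k + l) (f K.* g)
  support-* {k} {l} {f} {g} f∈ g∈ n =
    sum-closed (ZeroOr _) (inj₁ ≡.refl) ZeroOr-+ (suc n) (λ i → f (toℕ i) ℤ.* g (n ∸ toℕ i)) term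
    where
    lemma : ∀ k l t u M → (k + t * M) + (l + u * M) ≡ (k + l) + (t + u) * M
    lemma = solve-∀
    term : ∀ i → ZeroOr _ (f (toℕ i) ℤ.* g (n ∸ toℕ i))
    term i with f∈ (toℕ i) | g∈ (n ∸ toℕ i)
    ... | inj₁ f≡0 | _ = inj₁ (≡.trans (≡.cong (ℤ._* g (n ∸ toℕ i)) f≡0) (ℤ.*-zeroˡ (g (n ∸ toℕ i))))
    ... | inj₂ _ | inj₁ g≡0 = inj₁ (≡.trans (≡.cong (f (toℕ i) ℤ.*_) g≡0) (ℤ.*-zeroʳ (f (toℕ i))))
    ... | inj₂ (t , i≡) | inj₂ (u , n∸i≡) = inj₂ (t + u , (begin
      n                          ≡⟨ ℕ.m+[n∸m]≡n (toℕ≤pred[n] i) ⟨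
      toℕ i + (n ∸ toℕ i)        ≡⟨ ≡.cong₂ _+_ i≡ n∸i≡ ⟩
      (k + t * M) + (l + u * M)  ≡⟨ lemma k l t u M ⟩
      (k + l) + (t + u) * M      ∎))
      where open ≡.≡-Reasoning

  support-1 : SupportedIn 0 K.1#
  support-1 zero    = inj₂ (0 , ≡.refl)
  support-1 (suc n) = inj₁ ≡.refl

  support-^ : ∀ {k f} → SupportedIn k f → ∀ n → SupportedIn (n * k) (f ^ᴷ n)
  support-^ f∈ zero    = support-1
  support-^ {k} {f} f∈ (suc n) = support-* {k} {n * k} {f} {f ^ᴷ n} f∈ (support-^ {k} {f} f∈ n)

  support-X : SupportedIn 1 ℤ⟦q⟧.X
  support-X zero          = inj₁ ≡.refl
  support-X (suc zero)    = inj₂ (0 , ≡.refl)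
  support-X (suc (suc n)) = inj₁ ≡.refl

  support-X^ : ∀ k → SupportedIn k (ℤ⟦q⟧.X ^ᴷ k)
  support-X^ k = ≡.subst (λ l → SupportedIn l (ℤ⟦q⟧.X ^ᴷ k)) (ℕ.*-identityʳ k)
    (support-^ {1} {ℤ⟦q⟧.X} support-X k)

  support-X^M : SupportedIn 0 (ℤ⟦q⟧.X ^ᴷ M)
  support-X^M n with support-X^ M n
  ... | inj₁ f≡0      = inj₁ f≡0
  -- `M + t * M` is `suc t * M` by computation, so the offset M is absorbed.
  ... | inj₂ (t , n≡) = inj₂ (suc t , n≡)

  -- Yields, through `binomial⁻-closed`, that Gaussian binomials in base q^M are series in q^M.
  isSubsemiring : IsSubsemiring K.commutativeSemiring (SupportedIn 0)
  isSubsemiring = record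
    { resp     = λ f≈g f∈ n → ≡.subst (ZeroOr _) (f≈g n) (f∈ n)
    ; 0-closed = λ n → inj₁ (0ₛ-zero n)
    ; 1-closed = support-1
    ; +-closed = λ f∈ g∈ n → ZeroOr-+ (f∈ n) (g∈ n)
    ; *-closed = λ {f} {g} → support-* {0} {0} {f} {g}
    }

  open GaussianBinomials K.commutativeSemiring (ℤ⟦q⟧.X ^ᴷ M)
  open SubsemiringProperties isSubsemiring {ℤ⟦q⟧.X ^ᴷ M} support-X^M

  support-elementary : ∀ s n k → SupportedIn (k * s) (elementary (ℤ⟦q⟧.X ^ᴷ s) n k)
  support-elementary s n k = ≡.subst (λ l → SupportedIn l (elementary x n k)) (ℕ.+-identityʳ (k * s))
    (support-* {k * s} {0} {x ^ᴷ k} {Q^ K.* binomial n k} (support-^ {s} {x} (support-X^ s) k)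
      (support-* {0} {0} {Q^} {binomial n k}
        (^-closed {ℤ⟦q⟧.X ^ᴷ M} support-X^M (triangle k)) (binomial⁻-closed (suc n) k)))
    where
    x = ℤ⟦q⟧.X ^ᴷ s
    Q^ = (ℤ⟦q⟧.X ^ᴷ M) ^ᴷ triangle k

-- Comparing coefficients of two products by symmetrization.

sum-mono-≤ : ∀ e n (t u v w : Fin n → K.Carrier) →
  (∀ i → (t i K.+ u i) e ≤ℤ (v i K.+ w i) e) →
  (sumᴷ t K.+ sumᴷ u) e ≤ℤ (sumᴷ v K.+ sumᴷ w) e
sum-mono-≤ e zero    t u v w t+u≤v+w = ℤ.≤-refl
sum-mono-≤ e (suc n) t u v w t+u≤v+w = ≡.subst₂ _≤ℤ_
  (interchange (t fzero e) (u fzero e) _ _)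
  (interchange (v fzero e) (w fzero e) _ _)
  (ℤ.+-mono-≤ (t+u≤v+w fzero)
    (sum-mono-≤ e n (λ i → t (fsuc i)) (λ i → u (fsuc i)) (λ i → v (fsuc i)) (λ i → w (fsuc i))
      (λ i → t+u≤v+w (fsuc i))))

-- Undoes the doubling caused by adding the commuted copy.
i+i≤j+j⇒i≤j : ∀ {i j} → i ℤ.+ i ≤ℤ j ℤ.+ j → i ≤ℤ j
i+i≤j+j⇒i≤j {i} {j} 2i≤2j = ℤ.≮⇒≥ λ j<i → ℤ.<⇒≱ (ℤ.+-mono-< j<i j<i) 2i≤2j

-- Adding to a product its commuted copy pairs the term (i, j) with (j, i)
-- without reindexing the sum; the pairs then only need i ≥ j.
module Symmetrization (f f′ g g′ : ℕ → K.Carrier) (e : ℕ) where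

  left right : ℕ → ℕ → K.Carrier
  left  i j = f i K.* f′ j K.+ f′ i K.* f j
  right i j = g i K.* g′ j K.+ g′ i K.* g j

  *-coefficient-≤ : (∀ i j → left i j e ≤ℤ right i j e) →
    ∀ m → (f K⟦z⟧.* f′) m e ≤ℤ (g K⟦z⟧.* g′) m e
  *-coefficient-≤ termwise m = i+i≤j+j⇒i≤j (≡.subst₂ _≤ℤ_
    (≡.cong (λ x → (f K⟦z⟧.* f′) m e ℤ.+ x) (K⟦z⟧.*-comm f′ f m e))
    (≡.cong (λ x → (g K⟦z⟧.* g′) m e ℤ.+ x) (K⟦z⟧.*-comm g′ g m e))
    (sum-mono-≤ e (suc m)
      (λ i → f (toℕ i) K.* f′ (m ∸ toℕ i)) (λ i → f′ (toℕ i) K.* f (m ∸ toℕ i))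
      (λ i → g (toℕ i) K.* g′ (m ∸ toℕ i)) (λ i → g′ (toℕ i) K.* g (m ∸ toℕ i))
      (λ i → termwise (toℕ i) (m ∸ toℕ i))))

  left-sym : ∀ i j → left i j K.≈ left j i
  left-sym i j = K.trans
    (K.+-comm (f i K.* f′ j) (f′ i K.* f j))
    (K.+-cong (K.*-comm (f′ i) (f j)) (K.*-comm (f i) (f′ j)))

  right-sym : ∀ i j → right i j K.≈ right j i
  right-sym i j = K.trans
    (K.+-comm (g i K.* g′ j) (g′ i K.* g j))
    (K.+-cong (K.*-comm (g′ i) (g j)) (K.*-comm (g i) (g′ j)))

  -- `D l` will say that both shifts for l are integral. If it holds, the pairs compare directly; if
  -- not, the left side has coefficient 0 at e and nonnegativity of the right side suffices.
  module _ {D : ℕ → Set} (D? : ∀ l → Dec (D l))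
    (dominated : ∀ k l → D l → left (k + l) k e ≤ℤ right (k + l) k e)
    (vanishing : ∀ k l → ¬ D l → (f (k + l) K.* f′ k) e ≡ 0ℤ × (f′ (k + l) K.* f k) e ≡ 0ℤ)
    (g-nonneg : ∀ k → Nonneg (g k)) (g′-nonneg : ∀ k → Nonneg (g′ k)) where

    open IsSubsemiring Nonneg-isSubsemiring

    right-nonneg : ∀ i j → Nonneg (right i j)
    right-nonneg i j = +-closed {g i K.* g′ j} {g′ i K.* g j}
      (*-closed {g i} {g′ j} (g-nonneg i) (g′-nonneg j))
      (*-closed {g′ i} {g j} (g′-nonneg i) (g-nonneg j))

    shifted-≤ : ∀ k l → left (k + l) k e ≤ℤ right (k + l) k e
    shifted-≤ k l with D? l
    ... | yes l∈D = dominated k l l∈D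
    ... | no  l∉D = ≡.subst (_≤ℤ right (k + l) k e)
      (≡.sym (≡.cong₂ ℤ._+_ (proj₁ (vanishing k l l∉D)) (proj₂ (vanishing k l l∉D))))
      (right-nonneg (k + l) k e)

    left-≤-right : ∀ i j → left i j e ≤ℤ right i j e
    left-≤-right i j with ℕ.≤-total j i
    ... | inj₁ j≤i = ≡.subst (λ k → left k j e ≤ℤ right k j e)
      (ℕ.m+[n∸m]≡n j≤i) (shifted-≤ j (i ∸ j))
    ... | inj₂ i≤j = ≡.subst₂ _≤ℤ_ (left-sym j i e) (right-sym j i e)
      (≡.subst (λ k → left k i e ≤ℤ right k i e) (ℕ.m+[n∸m]≡n i≤j) (shifted-≤ i (j ∸ i)))

    symmetrized-≤ : ∀ m → (f K⟦z⟧.* f′) m e ≤ℤ (g K⟦z⟧.* g′) m e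
    symmetrized-≤ = *-coefficient-≤ left-≤-right

-- The inequality for given a, b, M at an admissible exponent.

power-exponent-≡ : ∀ {a b M l r} → a * l + M * r ≡ b * l →
  (ℤ⟦q⟧.X ^ᴷ a) ^ᴷ l K.* (ℤ⟦q⟧.X ^ᴷ M) ^ᴷ r K.≈ (ℤ⟦q⟧.X ^ᴷ b) ^ᴷ l
power-exponent-≡ {a} {b} {M} {l} {r} eq = begin
  (X ^ᴷ a) ^ᴷ l K.* (X ^ᴷ M) ^ᴷ r  ≈⟨ K.*-cong (^-assocʳ X a l) (^-assocʳ X M r) ⟩
  X ^ᴷ (a * l) K.* X ^ᴷ (M * r)    ≈⟨ ^-homo-* X (a * l) (M * r) ⟨
  X ^ᴷ (a * l + M * r)             ≡⟨ ≡.cong (X ^ᴷ_) eq ⟩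
  X ^ᴷ (b * l)                     ≈⟨ ^-assocʳ X b l ⟨
  (X ^ᴷ b) ^ᴷ l                    ∎
  where
  open import Relation.Binary.Reasoning.Setoid K.setoid
  X = ℤ⟦q⟧.X

module Difference (a b M : ℕ) (a<b : a < b) (2b<M : 2 * b < M) where

  X = ℤ⟦q⟧.X
  a′ = M ∸ a
  b′ = M ∸ b
  -- u = b - a and v = M - a - b are the numerators of the shifts r = l u / M and s = l v / M.
  u = b ∸ a
  v = b′ ∸ a

  b+b<M : b + b < M
  b+b<M = ≡.subst (λ k → b + k < M) (ℕ.+-identityʳ b) 2b<M

  b<b′ : b < b′
  b<b′ = ℕ.m+n≤o⇒m≤o∸n (suc b) b+b<M

  b≤M : b ≤ M
  b≤M = ℕ.m+n≤o⇒m≤o b (ℕ.<⇒≤ b+b<M)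

  b+b′≡M : b + b′ ≡ M
  b+b′≡M = ℕ.m+[n∸m]≡n b≤M

  a+a′≡M : a + a′ ≡ M
  a+a′≡M = ℕ.m+[n∸m]≡n (ℕ.≤-trans (ℕ.<⇒≤ a<b) b≤M)

  a+u≡b : a + u ≡ b
  a+u≡b = ℕ.m+[n∸m]≡n (ℕ.<⇒≤ a<b)

  a+v≡b′ : a + v ≡ b′
  a+v≡b′ = ℕ.m+[n∸m]≡n (ℕ.<⇒≤ (ℕ.<-trans a<b b<b′))

  -- Explains the shift r + s of the exchanged a-term.
  a+[u+v]≡a′ : a + (u + v) ≡ a′
  a+[u+v]≡a′ = ℕ.+-cancelˡ-≡ a _ _ (begin
    a + (a + (u + v))  ≡⟨ lemma a u v ⟩
    a + u + (a + v)    ≡⟨ ≡.cong₂ _+_ a+u≡b a+v≡b′ ⟩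
    b + b′             ≡⟨ ≡.trans b+b′≡M (≡.sym a+a′≡M) ⟩
    a + a′             ∎)
    where
    open ≡.≡-Reasoning
    lemma : ∀ a u v → a + (a + (u + v)) ≡ a + u + (a + v)
    lemma = solve-∀

  u<v : u < v
  u<v = ℕ.+-cancelˡ-< a u v (≡.subst₂ _<_ (≡.sym a+u≡b) (≡.sym a+v≡b′) b<b′)

  v≤M : v ≤ M
  v≤M = ℕ.≤-trans (ℕ.m∸n≤m b′ a) (ℕ.m∸n≤m M b)

  instance
    M≢0 : NonZero M
    M≢0 = ℕ.>-nonZero (ℕ.≤-<-trans z≤n b+b<M)

  open GaussianBinomials K.commutativeSemiring (X ^ᴷ M)
  open SubsemiringProperties Nonneg-isSubsemiring {X ^ᴷ M}
    (SubsemiringProperties.^-closed Nonneg-isSubsemiring {X} X-nonneg X-nonneg M)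
  open IsSubsemiring Nonneg-isSubsemiring
  open Support M using (support-elementary; support-*)

  ≼⇒≤ : ∀ f g → f ≼ g → ∀ e → f e ≤ℤ g e
  ≼⇒≤ f g (d , 0≤d , g≈f+d) e = ≡.subst₂ _≤ℤ_ (ℤ.+-identityʳ (f e)) (≡.sym (g≈f+d e))
    (ℤ.+-monoʳ-≤ (f e) (0≤d e))

  power-nonneg : ∀ k → Nonneg (X ^ᴷ k)
  power-nonneg = ^-closed {X} X-nonneg

  quotient-≤ : ∀ {l w r} → w ≤ M → l * w ≡ r * M → r ≤ l
  quotient-≤ {l} {w} {r} w≤M eq =
    ℕ.*-cancelʳ-≤ r l M (ℕ.≤-trans (ℕ.≤-reflexive (≡.sym eq)) (ℕ.*-monoʳ-≤ l w≤M))

  -- For l > 0, r = s would force u = v against `u<v`, and u, v ≤ M bounds both quotients by l.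
  quotients : ∀ l {r s} → l * u ≡ r * M → l * v ≡ s * M →
    (l ≡ 0 × r ≡ 0 × s ≡ 0) ⊎ (r ≢ s × r ≤ l × s ≤ l)
  quotients zero {r} {s} lu≡ lv≡ =
    inj₁ (≡.refl , ℕ.m*n≡0⇒m≡0 r M (≡.sym lu≡) , ℕ.m*n≡0⇒m≡0 s M (≡.sym lv≡))
  quotients l@(suc _) {r} lu≡ lv≡ = inj₂
    ( (λ { ≡.refl → ℕ.<⇒≢ u<v (ℕ.*-cancelˡ-≡ u v l (≡.trans lu≡ (≡.sym lv≡))) })
    , quotient-≤ (ℕ.≤-trans (ℕ.<⇒≤ u<v) v≤M) lu≡
    , quotient-≤ v≤M lv≡ )

  exponent-≡ : ∀ {c l w r} → a + w ≡ c → l * w ≡ r * M →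
    a * l + M * r ≡ c * l
  exponent-≡ {c} {l} {w} {r} a+w≡c lw≡ = begin
    a * l + M * r  ≡⟨ ≡.cong (a * l +_) (≡.trans (ℕ.*-comm M r) (≡.sym lw≡)) ⟩
    a * l + l * w  ≡⟨ ≡.cong (a * l +_) (ℕ.*-comm l w) ⟩
    a * l + w * l  ≡⟨ ℕ.*-distribʳ-+ l a w ⟨
    (a + w) * l    ≡⟨ ≡.cong (_* l) a+w≡c ⟩
    c * l          ∎
    where open ≡.≡-Reasoning

  sum-exponent : ∀ k l → k + l ≡ M → X ^ᴷ k K.* X ^ᴷ l K.≈ X ^ᴷ M
  sum-exponent k l k+l≡M = K.trans (K.sym (^-homo-* X k l)) (K.reflexive (≡.cong (X ^ᴷ_) k+l≡M))

  pair-≼ : ∀ n k l → M ∣ l * u → M ∣ l * v →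
    elementary (X ^ᴷ b) n (k + l) K.* elementary (X ^ᴷ b′) n k
      K.+ elementary (X ^ᴷ b′) n (k + l) K.* elementary (X ^ᴷ b) n k
    ≼ elementary (X ^ᴷ a) (suc n) (k + l) K.* elementary (X ^ᴷ a′) n k
      K.+ elementary (X ^ᴷ a′) n (k + l) K.* elementary (X ^ᴷ a) (suc n) k
  pair-≼ n k l (divides r lu≡) (divides s lv≡) = elementary-≼
    {X ^ᴷ a} {X ^ᴷ a′} {X ^ᴷ b} {X ^ᴷ b′} (power-nonneg a)
    (sum-exponent a a′ a+a′≡M) (sum-exponent b b′ b+b′≡M) n k l {r} {s}
    (quotients l lu≡ lv≡)
    (power-exponent-≡ {a} {b} {M} {l} {r} (exponent-≡ a+u≡b lu≡))
    (power-exponent-≡ {a} {b′} {M} {l} {s} (exponent-≡ a+v≡b′ lv≡))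
    (K.trans (K.*-congˡ {(X ^ᴷ a) ^ᴷ l} (K.sym (^-homo-* (X ^ᴷ M) r s)))
      (power-exponent-≡ {a} {a′} {M} {l} {r + s}
        (exponent-≡ a+[u+v]≡a′ (≡.trans (ℕ.*-distribˡ-+ l u v)
          (≡.trans (≡.cong₂ _+_ lu≡ lv≡) (≡.sym (ℕ.*-distribʳ-+ M r s)))))))

  -- For the exponents e of the theorem, a pair whose b-terms reach q^e has
  -- integral shifts r and s.
  Admissible : ℕ → Set
  Admissible e = ∀ l t → e ≡ l * b + t * M ⊎ e ≡ l * b′ + t * M →
    M ∣ l * u × M ∣ l * v

  -- One part from each class adds up to M modulo M, so k such pairs leave only the l excess parts:
  -- the product is supported on l c plus multiples of M.
  coefficient-zero : ∀ c c′ → c + c′ ≡ M → ∀ e n k l →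
    (∀ t → e ≢ l * c + t * M) →
    (elementary (X ^ᴷ c) n (k + l) K.* elementary (X ^ᴷ c′) n k) e ≡ 0ℤ
  coefficient-zero c c′ c+c′≡M e n k l e≢
    with support-* {(k + l) * c} {k * c′}
           {elementary (X ^ᴷ c) n (k + l)} {elementary (X ^ᴷ c′) n k}
           (support-elementary c n (k + l)) (support-elementary c′ n k) e
  ... | inj₁ ≡0 = ≡0
  ... | inj₂ (t , e≡) = contradiction (begin
    e                                    ≡⟨ e≡ ⟩
    (k + l) * c + k * c′ + t * M         ≡⟨ ≡.cong (λ M → (k + l) * c + k * c′ + t * M) c+c′≡M ⟨
    (k + l) * c + k * c′ + t * (c + c′)  ≡⟨ lemma k l t c c′ ⟩
    l * c + (k + t) * (c + c′)           ≡⟨ ≡.cong (λ M → l * c + (k + t) * M) c+c′≡M ⟩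
    l * c + (k + t) * M                  ∎) (e≢ (k + t))
    where
    open ≡.≡-Reasoning
    lemma : ∀ k l t c c′ → (k + l) * c + k * c′ + t * (c + c′)
      ≡ l * c + (k + t) * (c + c′)
    lemma = solve-∀

  module _ (n e : ℕ) (admissible : Admissible e) where

    coefficient-≤ : ∀ m →
      (elementary (X ^ᴷ b) n K⟦z⟧.* elementary (X ^ᴷ b′) n) m e
        ≤ℤ (elementary (X ^ᴷ a) (suc n) K⟦z⟧.* elementary (X ^ᴷ a′) n) m e
    coefficient-≤ = symmetrized-≤ (λ l → (M ∣? l * u) ×-dec (M ∣? l * v))
      (λ k l (M∣lu , M∣lv) →
        ≼⇒≤ (left (k + l) k) (right (k + l) k) (pair-≼ n k l M∣lu M∣lv) e)
      (λ k l ¬div →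
          coefficient-zero b b′ b+b′≡M e n k l (λ t e≡ → ¬div (admissible l t (inj₁ e≡)))
        , coefficient-zero b′ b (≡.trans (ℕ.+-comm b′ b) b+b′≡M) e n k l
            (λ t e≡ → ¬div (admissible l t (inj₂ e≡))))
      (elementary-closed {X ^ᴷ a} (power-nonneg a) (suc n))
      (elementary-closed {X ^ᴷ a′} (power-nonneg a′) n)
      where
      open Symmetrization (elementary (X ^ᴷ b) n) (elementary (X ^ᴷ b′) n)
        (elementary (X ^ᴷ a) (suc n)) (elementary (X ^ᴷ a′) n) e

    d-nonneg : ∀ m → 0ℤ ≤ℤ d a b M n m e
    d-nonneg m = ℤ.i≤j⇒0≤j-i (≡.subst₂ _≤ℤ_
      (≡.sym (pochhammer-*-coefficients b b′ n m e))
      (≡.sym (pochhammer-*-extend-coefficients a a′ n m e))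
      (coefficient-≤ m))
      where open PochhammerCoefficients ℤ⟦q⟧-commutativeRing X M

-- Admissibility of the two families of exponents.

odd∸odd : ∀ {m n} → m ≤ n → 2 ∤ m → 2 ∤ n → 2 ∣ n ∸ m
-- Both 1 + m and 1 + n are even, and they differ by n ∸ m.
odd∸odd {m} {n} m≤n 2∤m 2∤n = ∣m+n∣m⇒∣n
  (≡.subst (2 ∣_) (≡.cong suc (≡.sym (ℕ.m+[n∸m]≡n m≤n))) (2∤n⇒2∣1+n n 2∤n))
  (2∤n⇒2∣1+n m 2∤m)
  where
  2∤n⇒2∣1+n : ∀ n → 2 ∤ n → 2 ∣ suc n
  2∤n⇒2∣1+n zero          2∤n = contradiction (divides-refl 0) 2∤n
  2∤n⇒2∣1+n (suc zero)    2∤n = divides-refl 1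
  2∤n⇒2∣1+n (suc (suc n)) 2∤n =
    ∣m∣n⇒∣m+n (∣-refl {2}) (2∤n⇒2∣1+n n λ 2∣n → 2∤n (∣m∣n⇒∣m+n (∣-refl {2}) 2∣n))

-- Multiplying e by c and reducing modulo M gives M ∣ b (c l), from which b is cancelled. The
-- multiplier c is 1 for e = n M and 2 for e = n M + M / 2.
coprime⇒∣-multiplicity : ∀ {b b′ M c e l t} → Coprime M b → b + b′ ≡ M → M ∣ c * e →
  e ≡ l * b + t * M ⊎ e ≡ l * b′ + t * M → M ∣ c * l
coprime⇒∣-multiplicity {b} {b′} {M} {c} {e} {l} {t} M⊥b b+b′≡M M∣ce e≡ =
  coprime-divisor M⊥b (M∣b[cl] e≡)
  where
  lemma : ∀ c l k t M → c * (l * k + t * M) ≡ c * t * M + k * (c * l)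
  lemma = solve-∀

  M∣k[cl] : ∀ k → e ≡ l * k + t * M → M ∣ k * (c * l)
  M∣k[cl] k ≡.refl = ∣m+n∣m⇒∣n (≡.subst (M ∣_) (lemma c l k t M) M∣ce) (∣n⇒∣m*n (c * t) ∣-refl)

  M∣b[cl] : e ≡ l * b + t * M ⊎ e ≡ l * b′ + t * M → M ∣ b * (c * l)
  M∣b[cl] (inj₁ e≡) = M∣k[cl] b e≡
  -- Since b′ is -b modulo M, divisibility of b′ (c l) passes to b (c l).
  M∣b[cl] (inj₂ e≡) = ∣m+n∣m⇒∣n
    (≡.subst (M ∣_) (≡.trans (≡.cong (_* (c * l)) (≡.trans (≡.sym b+b′≡M) (ℕ.+-comm b b′)))
      (ℕ.*-distribʳ-+ (c * l) b′ b)) (m∣m*n (c * l)))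
    (M∣k[cl] b′ e≡)

theorem1p3 : (a b M : ℕ) → 1 ≤ a → a < b → 2 * b < M → gcd b M ≡ 1 →
    ((L m n : ℕ) → 0ℤ ≤ℤ d a b M L m (n * M))
    × (2 ∣ M → 2 ∤ a → (L m n : ℕ) → 0ℤ ≤ℤ d a b M L m (n * M + M / 2))
theorem1p3 a b M _ a<b 2b<M gcd≡1 = multiples , half-multiples
  where
  open Difference a b M a<b 2b<M

  M⊥b : Coprime M b
  M⊥b = Coprimality.sym (gcd≡1⇒coprime gcd≡1)

  multiples : (L m n : ℕ) → 0ℤ ≤ℤ d a b M L m (n * M)
  multiples L m n = d-nonneg L (n * M) admissible m
    where
    admissible : Admissible (n * M)
    admissible l t e≡ = ∣m⇒∣m*n u M∣l , ∣m⇒∣m*n v M∣l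
      where
      M∣l : M ∣ l
      M∣l = ≡.subst (M ∣_) (ℕ.*-identityˡ l)
        (coprime⇒∣-multiplicity {c = 1} {l = l} {t = t} M⊥b b+b′≡M (∣n⇒∣m*n 1 (∣n⇒∣m*n n ∣-refl)) e≡)

  half-multiples : 2 ∣ M → 2 ∤ a → (L m n : ℕ) → 0ℤ ≤ℤ d a b M L m (n * M + M / 2)
  half-multiples 2∣M 2∤a L m n = d-nonneg L (n * M + M / 2) admissible m
    where
    2∤b : 2 ∤ b
    2∤b 2∣b with () ← ∣1⇒≡1 (≡.subst (2 ∣_) gcd≡1 (gcd-greatest 2∣b 2∣M))

    2∤b′ : 2 ∤ b′
    2∤b′ 2∣b′ = 2∤b (∣m+n∣m⇒∣n (≡.subst (2 ∣_) (≡.trans (≡.sym b+b′≡M) (ℕ.+-comm b b′)) 2∣M) 2∣b′)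

    M∣2e : M ∣ 2 * (n * M + M / 2)
    -- 2 (n M + M / 2) = (2 n + 1) M, as M is even.
    M∣2e = divides (suc (2 * n)) (≡.trans (lemma n M (M / 2)) (≡.cong (_+ 2 * n * M) (m/n*n≡m 2∣M)))
      where
      lemma : ∀ n M h → 2 * (n * M + h) ≡ h * 2 + 2 * n * M
      lemma = solve-∀

    -- Here only M ∣ 2 l is available; but a, b and b′ are odd, so u and v are even and l u, l v are
    -- multiples of 2 l.
    admissible : Admissible (n * M + M / 2)
    admissible l t e≡ =
        M∣l* u (odd∸odd (ℕ.<⇒≤ a<b) 2∤a 2∤b)
      , M∣l* v (odd∸odd (ℕ.<⇒≤ (ℕ.<-trans a<b b<b′)) 2∤a 2∤b′)
      where
      M∣l* : ∀ w → 2 ∣ w → M ∣ l * w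
      M∣l* _ (divides-refl k) = ≡.subst (M ∣_) (lemma l k)
        (∣m⇒∣m*n k (coprime⇒∣-multiplicity {c = 2} {l = l} {t = t} M⊥b b+b′≡M M∣2e e≡))
        where
        lemma : ∀ l k → 2 * l * k ≡ l * (k * 2)
        lemma = solve-∀
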